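{- For every fixed cycle $\mathbf{C}$ of the compressor, every element of $\mathbf{C}$ is a BURD rotor type.
   Context: A two-state rotor type is an infinite periodic sequence $r=(r^{(1)},r^{(2)},\dots)$ over two states with fundamental period $|r|$; rotor types are considered up to equivalence (injective relabeling of states), and each is represented over $\{1,2\}$ with $r^{(1)}=1$. $r$ is balanced if its two states occur equally often in a period. A run is a contiguous block of consecutive positions; it is balanced if it contains equally many $1$'s and $2$'s, uniform if all its terms are equal. A balanced run decomposition (BRD) of a balanced $r$ is a partition of the period of $r$ into contiguous balanced runs; its type is the infinite periodic sequence $(b_1,b_2,\dots)$ where $2b_i$ is the length of the $i$-th run, $i$ taken modulo the number of runs. A uniform run decomposition (URD) of $r$ is a partition of the period of $r$ into contiguous uniform runs; its type is the infinite periodic sequence $(u_1,u_2,\dots)$ of run lengths, $i$ taken modulo the number of runs. A BURD rotor type is a balanced rotor type having a BRD and a URD of the same type. Rotor-router dynamics: at each non-target vertex $v$ there is a periodic sequence $e_v^{(1)},e_v^{(2)},\dots$ of out-edges; a particle starts at the source, on its $j$-th visit to $v$ leaves along $e_v^{(j)}$, and whenever it reaches a target it is returned to the source; the hitting sequence is the (periodic) sequence of targets reached. The compressor for $r$ has non-target vertices $1$ (source), $2,3$ and targets $4,5$. On the $j$-th departure: from vertex $1$ the particle goes to vertex $2$ if $r^{(j)}=1$ and to vertex $3$ if $r^{(j)}=2$; from vertex $2$, in variant $U$ it goes to vertex $1$ if $r^{(j)}=1$ and to target $4$ if $r^{(j)}=2$, in variant $D$ to target $4$ if $r^{(j)}=1$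 and to vertex $1$ if $r^{(j)}=2$; from vertex $3$ likewise with target $5$. For $X,Y\in\{U,D\}$ the compressor operation $XY$ sends $r$ to the hitting sequence with variant $X$ at vertex $2$ and $Y$ at vertex $3$, viewed as a rotor type. A fixed cycle of the compressor is a set $\mathbf{C}$ of rotor types, closed under the four operations $UU,UD,DU,DD$, such that any element of $\mathbf{C}$ can be reached from any other element by some finite sequence of compressor operations. -}

module Defs where

open import Level using (Level)
open import Data.Nat using (ℕ; zero; suc; _+_; _*_; _≤_; _<_; ⌊_/2⌋)
open import Data.Nat.DivMod using (_mod_)
open import Data.Fin using (Fin)
import Data.Fin
open import Data.Vec using (Vec; lookup; toList)
open import Data.List using (List; []; _∷_; concat; map; length)
import Data.List as L
open import Data.List.Relation.Unary.All using (All)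
open import Data.Product using (Σ; _×_; _,_; ∃)
open import Data.Maybe using (Maybe; just; nothing)
open import Relation.Binary.PropositionalEquality using (_≡_; _≢_)
open import Relation.Binary.Construct.Closure.ReflexiveTransitive using (Star)
open import Function.Definitions using (Injective)

data St : Set where
  ① ② : St

seqV : ∀ {k} → Vec St (suc k) → ℕ → St
seqV {k} w n = lookup w (n mod suc k)

HasPeriod : (ℕ → St) → ℕ → Set
HasPeriod s d = ∀ i → s (i + d) ≡ s i

-- A rotor type, represented canonically: period word of length |r| = suc k
-- equal to the fundamental period, normalised (relabelled) so that r⁽¹⁾ = ①.
record RotorType : Set where
  field
    k         : ℕ
    word      : Vec St (suc k)
    startsOne : lookup word Data.Fin.zero ≡ ①
    isPrimitive : ∀ d → 0 < d → HasPeriod (seqV word) d → suc k ≤ d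
open RotorType public

-- r⁽ⁿ⁺¹⁾ (0-indexed)
at : RotorType → ℕ → St
at r n = seqV (word r) n

period : RotorType → List St
period r = toList (word r)

count : St → List St → ℕ
count x [] = 0
count ① (① ∷ ys) = suc (count ① ys)
count ① (② ∷ ys) = count ① ys
count ② (① ∷ ys) = count ② ys
count ② (② ∷ ys) = suc (count ② ys)

BalancedL : List St → Set
BalancedL w = count ① w ≡ count ② w

Balanced : RotorType → Set
Balanced r = BalancedL (period r)

NonEmptyRun : List St → Set
NonEmptyRun b = b ≢ []

Uniform : List St → Set
Uniform b = ∃ λ x → All (_≡ x) b

record BRD (w : List St) : Set where
  field
    runs     : List (List St)
    covers   : concat runs ≡ w
    nonEmpty : All NonEmptyRun runs
    balanced : All BalancedL runs
open BRD public

brdType : ∀ {w} → BRD w → List ℕ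
brdType D = map (λ b → ⌊ length b /2⌋) (runs D)

record URD (w : List St) : Set where
  field
    runs     : List (List St)
    covers   : concat runs ≡ w
    nonEmpty : All NonEmptyRun runs
    uniform  : All Uniform runs
open URD public

urdType : ∀ {w} → URD w → List ℕ
urdType D = map length (URD.runs D)

cycAt : List ℕ → ℕ → Maybe ℕ
cycAt [] _ = nothing
cycAt (x ∷ xs) i = just (L.lookup (x ∷ xs) (i mod suc (length xs)))

SameType : List ℕ → List ℕ → Set
SameType xs ys = ∀ i → cycAt xs i ≡ cycAt ys i

BURD : RotorType → Set
BURD r = Balanced r ×
  Σ (BRD (period r)) λ B → Σ (URD (period r)) λ U → SameType (brdType B) (urdType U)

data Var : Set where
  U D : Var

data Tgt : Set where
  t4 t5 : Tgt

data Vtx : Set where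
  v1 v2 v3 : Vtx

data Next : Set where
  back hit : Next

-- from vertex 2 (resp. 3) with variant X reading rotor value s:
-- back = go to vertex 1, hit = go to target 4 (resp. 5)
route : Var → St → Next
route U ① = back
route U ② = hit
route D ① = hit
route D ② = back

-- numbers of departures so far from vertices 1,2,3
record Cfg : Set where
  constructor cfg
  field
    n1 n2 n3 : ℕ

-- Walk X Y r v c c' t : the particle at vertex v, with departure counters c,
-- eventually reaches target t, the counters then being c'.
-- The (j+1)-th departure from a vertex uses r⁽ʲ⁺¹⁾ = at r j.
data Walk (X Y : Var) (r : RotorType) : Vtx → Cfg → Cfg → Tgt → Set where
  1→2 : ∀ {a b c c' t} → at r a ≡ ① →
        Walk X Y r v2 (cfg (suc a) b c) c' t → Walk X Y r v1 (cfg a b c) c' t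
  1→3 : ∀ {a b c c' t} → at r a ≡ ② →
        Walk X Y r v3 (cfg (suc a) b c) c' t → Walk X Y r v1 (cfg a b c) c' t
  2→1 : ∀ {a b c c' t} → route X (at r b) ≡ back →
        Walk X Y r v1 (cfg a (suc b) c) c' t → Walk X Y r v2 (cfg a b c) c' t
  2→4 : ∀ {a b c} → route X (at r b) ≡ hit →
        Walk X Y r v2 (cfg a b c) (cfg a (suc b) c) t4
  3→1 : ∀ {a b c c' t} → route Y (at r c) ≡ back →
        Walk X Y r v1 (cfg a b (suc c)) c' t → Walk X Y r v3 (cfg a b c) c' t
  3→5 : ∀ {a b c} → route Y (at r c) ≡ hit →
        Walk X Y r v3 (cfg a b c) (cfg a b (suc c)) t5

data After (X Y : Var) (r : RotorType) : ℕ → Cfg → Set where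
  start : After X Y r 0 (cfg 0 0 0)
  next  : ∀ {n c c' t} → After X Y r n c → Walk X Y r v1 c c' t →
          After X Y r (suc n) c'

Hits : Var → Var → RotorType → ℕ → Tgt → Set
Hits X Y r n t = Σ Cfg λ c → Σ Cfg λ c' → After X Y r n c × Walk X Y r v1 c c' t

-- Op X Y r s : the compressor operation XY sends r to s, i.e. the hitting
-- sequence exists and equals s up to an injective relabelling of states.
Op : Var → Var → RotorType → RotorType → Set
Op X Y r s = Σ (Tgt → St) λ ρ → Injective _≡_ _≡_ ρ ×
  (∀ n → Σ Tgt λ t → Hits X Y r n t × ρ t ≡ at s n)

OneOp : RotorType → RotorType → Set
OneOp r s = Σ Var λ X → Σ Var λ Y → Op X Y r s

Reachable : RotorType → RotorType → Set
Reachable = Star OneOp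

record FixedCycle {ℓ : Level} (C : RotorType → Set ℓ) : Set ℓ where
  field
    closed    : ∀ r → C r → ∀ X Y → Σ RotorType λ s → Op X Y r s × C s
    connected : ∀ r s → C r → C s → Reachable r s

-- Let N₁(t), N₂(t) count the letters among the first t letters of r. After t departures from
-- vertex 1 the targets have been hit N_x(N₁(t)) and N_y(N₂(t)) times, where x and y are the
-- letters that variants X and Y send to a target. UD makes r balanced, and every operation then
-- keeps a common balanced period 2g, so F(r) = Σ_{1≤t≤2g} |N₁(t) − N₂(t)| compares all elements
-- of the cycle. Since |k − l| is the number of 1s plus the number of 2s between positions k and l,
-- 2F(r) = F(UU r) + F(DD r) + slack with slack ≥ 0. Slack zero forces the prefix of length 2i to
-- be balanced whenever letters i and i + 1 of r differ, and for such r both UD and DU act as the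
-- identity. Hence from an element of minimal F all four operations stay at minimal F, and every
-- element of the cycle has slack zero. Cutting such an r at the i with balanced prefix of length
-- 2i gives the URD, and cutting it at the corresponding 2i gives the BRD of the same type.
--
-- BURD types themselves are not closed under UU and DD, so invariance alone would not suffice.
module Submission where

open import Defs
open import Level using (Level)

open import Data.Nat
open import Data.Nat.Properties
open import Data.Nat.DivMod using (_mod_; m%n<n; m<n⇒m%n≡m; [m+n]%n≡m%n; m∣n⇒o%n%m≡o%m; m≡m%n+[m/n]*n)
open import Data.Nat.Divisibility using (divides)
open import Data.Nat.Induction using (<-wellFounded)
open import Data.Nat.Tactic.RingSolver using (solve-∀)
open import Data.Fin as Fin using (Fin; toℕ)
open import Data.Fin.Properties using (toℕ-injective; toℕ-fromℕ<; toℕ<n)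
open import Data.Vec as Vec using (Vec; toList)
open import Data.List using (List; []; _∷_; _++_; concat; length; map; applyUpTo)
open import Data.Nat.ListAction using (sum)
import Data.List as List
open import Data.List.Properties using (length-++; length-applyUpTo)
open import Data.List.Relation.Unary.All as All using (All; []; _∷_)
import Data.List.Relation.Unary.All.Properties as All
open import Data.Maybe using (Maybe; just; nothing)
open import Data.Product using (Σ; ∃; _×_; _,_; proj₁; proj₂)
open import Data.Sum using (_⊎_; inj₁; inj₂)
open import Function using (_∘_)
open import Function.Definitions using (Injective)
open import Induction.WellFounded using (Acc; acc)
open import Relation.Nullary using (¬_; Dec; yes; no; contradiction)
open import Relation.Binary.PropositionalEquality
open import Relation.Binary.Construct.Closure.ReflexiveTransitive using (ε; _◅_)

-- Counting letters in prefixes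

ind : St → St → ℕ
ind ① ① = 1
ind ① ② = 0
ind ② ① = 0
ind ② ② = 1

cnt : St → (ℕ → St) → ℕ → ℕ
cnt x w zero    = 0
cnt x w (suc n) = ind x (w n) + cnt x w n

other : St → St
other ① = ②
other ② = ①

_≟ˢ_ : (x y : St) → Dec (x ≡ y)
① ≟ˢ ① = yes refl
① ≟ˢ ② = no λ ()
② ≟ˢ ① = no λ ()
② ≟ˢ ② = yes refl

≢other : ∀ x → x ≢ other x
≢other ① ()
≢other ② ()

≢⇒≡other : ∀ {x y} → x ≢ y → y ≡ other x
≢⇒≡other {①} {①} x≢y = contradiction refl x≢y
≢⇒≡other {①} {②} x≢y = refl
≢⇒≡other {②} {①} x≢y = refl
≢⇒≡other {②} {②} x≢y = contradiction refl x≢y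

≡⊎≡ : ∀ {x y} → x ≢ y → ∀ z → z ≡ x ⊎ z ≡ y
≡⊎≡ {x} x≢y z with z ≟ˢ x
... | yes z≡x = inj₁ z≡x
... | no  z≢x = inj₂ (trans (≢⇒≡other (z≢x ∘ sym)) (sym (≢⇒≡other x≢y)))

ind-refl : ∀ x → ind x x ≡ 1
ind-refl ① = refl
ind-refl ② = refl

ind-≢ : ∀ {x y} → x ≢ y → ind x y ≡ 0
ind-≢ {①} {①} x≢y = contradiction refl x≢y
ind-≢ {①} {②} x≢y = refl
ind-≢ {②} {①} x≢y = refl
ind-≢ {②} {②} x≢y = contradiction refl x≢y

ind-both : ∀ x z → ind x z + ind (other x) z ≡ 1
ind-both ① ① = refl
ind-both ① ② = refl
ind-both ② ① = refl
ind-both ② ② = refl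

ind-0⊎1 : ∀ x z → ind x z ≡ 0 ⊎ ind x z ≡ 1
ind-0⊎1 ① ① = inj₂ refl
ind-0⊎1 ① ② = inj₁ refl
ind-0⊎1 ② ① = inj₁ refl
ind-0⊎1 ② ② = inj₂ refl

cnt-hit : ∀ x w n → w n ≡ x → cnt x w (suc n) ≡ suc (cnt x w n)
cnt-hit x w n refl = cong (_+ cnt x w n) (ind-refl x)

cnt-miss : ∀ x w n → x ≢ w n → cnt x w (suc n) ≡ cnt x w n
cnt-miss x w n x≢ = cong (_+ cnt x w n) (ind-≢ x≢)

cnt-cong : ∀ x {v w} → (∀ n → v n ≡ w n) → ∀ n → cnt x v n ≡ cnt x w n
cnt-cong x v≗w zero    = refl
cnt-cong x v≗w (suc n) = cong₂ _+_ (cong (ind x) (v≗w n)) (cnt-cong x v≗w n)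

cnt-+ : ∀ x w m n → cnt x w (m + n) ≡ cnt x w m + cnt x (λ i → w (m + i)) n
cnt-+ x w m zero    = trans (cong (cnt x w) (+-identityʳ m)) (sym (+-identityʳ _))
cnt-+ x w m (suc n) rewrite +-suc m n | cnt-+ x w m n =
  lemma (ind x (w (m + n))) (cnt x w m) _
  where
  lemma : ∀ a b c → a + (b + c) ≡ b + (a + c)
  lemma = solve-∀

cnt-both : ∀ {x y} → x ≢ y → ∀ w n → cnt x w n + cnt y w n ≡ n
cnt-both x≢y w zero = refl
cnt-both {x} x≢y w (suc n) with refl ← ≢⇒≡other x≢y = begin
  (ind x z + cnt x w n) + (ind (other x) z + cnt (other x) w n)
    ≡⟨ lemma (ind x z) _ (ind (other x) z) _ ⟩
  (ind x z + ind (other x) z) + (cnt x w n + cnt (other x) w n)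
    ≡⟨ cong₂ _+_ (ind-both x z) (cnt-both x≢y w n) ⟩
  suc n ∎
  where
  open ≡-Reasoning
  z = w n
  lemma : ∀ a b c d → (a + b) + (c + d) ≡ (a + c) + (b + d)
  lemma = solve-∀

cnt-mono : ∀ x w {m n} → m ≤ n → cnt x w m ≤ cnt x w n
cnt-mono x w {m} {n} m≤n =
  subst (cnt x w m ≤_)
    (trans (sym (cnt-+ x w m (n ∸ m))) (cong (cnt x w) (m+[n∸m]≡n m≤n)))
    (m≤m+n (cnt x w m) _)

cnt-cancel-< : ∀ x w {m n} → cnt x w m < cnt x w n → m < n
cnt-cancel-< x w {m} {n} lt with n ≤? m
... | yes n≤m = contradiction (cnt-mono x w n≤m) (<⇒≱ lt)
... | no  n≰m = ≰⇒> n≰m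

cnt-crossing : ∀ x w {K} n → K < cnt x w n → ∃ λ a → a < n × cnt x w a ≡ K × w a ≡ x
cnt-crossing x w {K} (suc n) K< with K <? cnt x w n
... | yes K<′ = let a , a<n , eq , wa = cnt-crossing x w n K<′ in a , m<n⇒m<1+n a<n , eq , wa
... | no  K≮ with w n ≟ˢ x
...   | yes wn = n , ≤-refl , ≤-antisym (≮⇒≥ K≮) (s≤s⁻¹ (subst (K <_) (cnt-hit x w n wn) K<)) , wn
...   | no  wn = contradiction (subst (K <_) (cnt-miss x w n (wn ∘ sym)) K<) K≮

-- Increments of the counts only give `ind x (v n) ≡ ind y (w n)`; the common first letter then
-- forces `x ≡ y`. Outputs are known up to relabelling, and this is how normalisation removes the
-- relabelling.
counts-determine : ∀ {x y v w} → (∀ n → cnt x v n ≡ cnt y w n) → v 0 ≡ w 0 → ∀ n → v n ≡ w n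
counts-determine {x} {y} {v} {w} same v0≡w0 n =
  ind-injective (subst (λ y → ind x (v n) ≡ ind y (w n)) (sym x≡y) (same-ind n))
  where
  same-ind : ∀ n → ind x (v n) ≡ ind y (w n)
  same-ind n = +-cancelʳ-≡ (cnt x v n) _ _
    (trans (same (suc n)) (cong (ind y (w n) +_) (sym (same n))))
  ind-injectiveˡ : ∀ {x y} z → ind x z ≡ ind y z → x ≡ y
  ind-injectiveˡ {①} {①} z  _ = refl
  ind-injectiveˡ {①} {②} ① ()
  ind-injectiveˡ {①} {②} ② ()
  ind-injectiveˡ {②} {①} ① ()
  ind-injectiveˡ {②} {①} ② ()
  ind-injectiveˡ {②} {②} z  _ = refl
  ind-injective : ∀ {x y z} → ind x y ≡ ind x z → y ≡ z
  ind-injective {①} {①} {①} _ = refl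
  ind-injective {①} {②} {②} _ = refl
  ind-injective {②} {①} {①} _ = refl
  ind-injective {②} {②} {②} _ = refl
  x≡y : x ≡ y
  x≡y = ind-injectiveˡ (w 0) (subst (λ z → ind x z ≡ ind y (w 0)) v0≡w0 (same-ind 0))

-- The hitting sequence in terms of prefix counts

hitLetter : Var → St
hitLetter U = ②
hitLetter D = ①

letter : Tgt → St
letter t4 = ①
letter t5 = ②

route-hit : ∀ Z z → route Z z ≡ hit → z ≡ hitLetter Z
route-hit U ② _ = refl
route-hit D ① _ = refl

route-back : ∀ Z z → route Z z ≡ back → hitLetter Z ≢ z
route-back U ① _ ()
route-back D ② _ ()

letter-injective : ∀ {u t} → letter u ≡ letter t → u ≡ t
letter-injective {t4} {t4} _ = refl
letter-injective {t5} {t5} _ = refl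

variant : Var → Var → Tgt → Var
variant X Y t4 = X
variant X Y t5 = Y

-- The number of hits of t during the first a departures from vertex 1.
hits : Var → Var → (ℕ → St) → Tgt → ℕ → ℕ
hits X Y w t a = cnt (hitLetter (variant X Y t)) w (cnt (letter t) w a)

total : Var → Var → (ℕ → St) → ℕ → ℕ
total X Y w a = hits X Y w t4 a + hits X Y w t5 a

-- Trades walks for equations between prefix counts, indexed by the number `a` of departures from
-- vertex 1. A departure that leads back to vertex 1 leaves the total unchanged; `reach` ensures
-- that every prefix of `s` is still described by some `a`.
record Output (X Y : Var) (w s : ℕ → St) : Set where
  field
    label     : Tgt → St
    injective : Injective _≡_ _≡_ label
    tally     : ∀ t a → cnt (label t) s (total X Y w a) ≡ hits X Y w t a
    reach     : ∀ n → ∃ λ a → total X Y w a ≡ n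

hits-mono : ∀ X Y w t {a b} → a ≤ b → hits X Y w t a ≤ hits X Y w t b
hits-mono X Y w t a≤b = cnt-mono _ w (cnt-mono _ w a≤b)

sum-tight : ∀ {f g : Tgt → ℕ} t → f t4 + f t5 ≡ g t4 + g t5 → (∀ u → f u ≤ g u) → f t ≡ g t
sum-tight t4 eq f≤g = ≤-antisym (f≤g t4) (≮⇒≥ λ lt → <⇒≢ (+-mono-<-≤ lt (f≤g t5)) eq)
sum-tight t5 eq f≤g = ≤-antisym (f≤g t5) (≮⇒≥ λ lt → <⇒≢ (+-mono-≤-< (f≤g t4) lt) eq)

module _ (X Y : Var) (r : RotorType) where
  private
    w = at r

  indT : Tgt → Tgt → ℕ
  indT t t′ = ind (letter t) (letter t′)

  -- Whenever the particle is at vertex 1, it has left vertices 2 and 3 as often as it entered them,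
  -- so the departures from vertex 1 fix all three counters.
  state : ℕ → Cfg
  state a = cfg a (cnt ① w a) (cnt ② w a)

  Arrives : ℕ → Cfg → Tgt → Set
  Arrives a c t = Σ ℕ λ a′ → c ≡ state a′ ×
    (∀ u → hits X Y w u a′ ≡ indT u t + hits X Y w u a)

  hits-step : ∀ t u a → w a ≡ letter t →
    hits X Y w u (suc a) ≡
      indT u t * ind (hitLetter (variant X Y t)) (w (cnt (letter t) w a)) + hits X Y w u a
  hits-step t u a wa with letter u ≟ˢ letter t
  ... | yes eq with refl ← letter-injective eq = trans
          (cong (cnt (hitLetter (variant X Y t)) w) (cnt-hit (letter t) w a wa))
          (cong (_+ hits X Y w t a) (sym (trans (cong (_* z) (ind-refl (letter t))) (*-identityˡ z))))
    where
    z = ind (hitLetter (variant X Y t)) (w (cnt (letter t) w a))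
  ... | no ≢ = trans
          (cong (cnt (hitLetter (variant X Y u)) w) (cnt-miss (letter u) w a (λ eq → ≢ (trans eq wa))))
          (cong (λ i → i * ind (hitLetter (variant X Y t)) (w (cnt (letter t) w a)) + hits X Y w u a)
            (sym (ind-≢ ≢)))

  hits-hit : ∀ t u a → w a ≡ letter t → route (variant X Y t) (w (cnt (letter t) w a)) ≡ hit →
    hits X Y w u (suc a) ≡ indT u t + hits X Y w u a
  hits-hit t u a wa rb = trans (hits-step t u a wa) (cong (_+ hits X Y w u a)
    (trans (cong (λ z → indT u t * ind (hitLetter (variant X Y t)) z) (route-hit (variant X Y t) _ rb))
    (trans (cong (indT u t *_) (ind-refl (hitLetter (variant X Y t)))) (*-identityʳ _))))

  hits-back : ∀ t u a → w a ≡ letter t → route (variant X Y t) (w (cnt (letter t) w a)) ≡ back →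
    hits X Y w u (suc a) ≡ hits X Y w u a
  hits-back t u a wa rb = trans (hits-step t u a wa) (cong (_+ hits X Y w u a)
    (trans (cong (indT u t *_) (ind-≢ (route-back (variant X Y t) _ rb))) (*-zeroʳ (indT u t))))

  -- The counters enter through equations because the rest of a walk carries, say,
  -- `suc (cnt ① w a)`, which agrees with `cnt ① w (suc a)` only thanks to the letter just read.
  walk-arrives : ∀ a {b c c′ t} → b ≡ cnt ① w a → c ≡ cnt ② w a →
    Walk X Y r v1 (cfg a b c) c′ t → Arrives a c′ t
  walk-arrives a refl refl (1→2 wa (2→1 rb rest))
    with a′ , eq , step ← walk-arrives (suc a) (sym (cnt-hit ① w a wa))
           (sym (cnt-miss ② w a (λ eq → ≢other ② (trans eq wa)))) rest
    = a′ , eq , λ u → trans (step u) (cong (indT u _ +_) (hits-back t4 u a wa rb))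
  walk-arrives a refl refl (1→3 wa (3→1 rb rest))
    with a′ , eq , step ← walk-arrives (suc a) (sym (cnt-miss ① w a (λ eq → ≢other ① (trans eq wa))))
           (sym (cnt-hit ② w a wa)) rest
    = a′ , eq , λ u → trans (step u) (cong (indT u _ +_) (hits-back t5 u a wa rb))
  walk-arrives a refl refl (1→2 wa (2→4 rb)) = suc a ,
    cong₂ (cfg (suc a)) (sym (cnt-hit ① w a wa)) (sym (cnt-miss ② w a (λ eq → ≢other ② (trans eq wa)))) ,
    λ u → hits-hit t4 u a wa rb
  walk-arrives a refl refl (1→3 wa (3→5 rb)) = suc a ,
    cong₂ (cfg (suc a)) (sym (cnt-miss ① w a (λ eq → ≢other ① (trans eq wa)))) (sym (cnt-hit ② w a wa)) ,
    λ u → hits-hit t5 u a wa rb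

  total-arrives : ∀ t a a′ → (∀ u → hits X Y w u a′ ≡ indT u t + hits X Y w u a) →
    total X Y w a′ ≡ suc (total X Y w a)
  total-arrives t4 a a′ step = cong₂ _+_ (step t4) (step t5)
  total-arrives t5 a a′ step = trans (cong₂ _+_ (step t4) (step t5)) (+-suc (hits X Y w t4 a) _)

  after-total : ∀ {n c} → After X Y r n c → Σ ℕ λ a → c ≡ state a × total X Y w a ≡ n
  after-total start = 0 , refl , refl
  after-total (next {t = t} before walk)
    with a , refl , eq ← after-total before
    with a′ , refl , step ← walk-arrives a refl refl walk
    = a′ , refl , trans (total-arrives t a a′ step) (cong suc eq)

  -- Several departure counts can share a total. Both hit counts are monotone, so neither can grow
  -- while their sum stays put.
  hits-determined : ∀ t a a′ → total X Y w a ≡ total X Y w a′ → hits X Y w t a ≡ hits X Y w t a′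
  hits-determined t a a′ eq with ≤-total a a′
  ... | inj₁ a≤a′ = sum-tight t eq (λ u → hits-mono X Y w u a≤a′)
  ... | inj₂ a′≤a = sym (sum-tight t (sym eq) (λ u → hits-mono X Y w u a′≤a))

  -- Induction on the number of hits: the walk making the next hit raises only the tally of its own
  -- target, and the next letter of `s` is the label of that target.
  op-output : ∀ s → Op X Y r s → Output X Y w (at s)
  op-output s (ρ , inj , hit-at) = record
    { label = ρ ; injective = inj ; tally = λ t a → tally _ t a refl ; reach = reach }
    where
    reach : ∀ n → ∃ λ a → total X Y w a ≡ n
    reach n with _ , (_ , _ , before , _) , _ ← hit-at n
            with a , _ , eq ← after-total before = a , eq
    ind-ρ : ∀ u t → ind (ρ u) (ρ t) ≡ indT u t
    ind-ρ t4 t4 = ind-refl (ρ t4)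
    ind-ρ t5 t5 = ind-refl (ρ t5)
    ind-ρ t4 t5 = ind-≢ λ eq → contradiction (inj eq) λ ()
    ind-ρ t5 t4 = ind-≢ λ eq → contradiction (inj eq) λ ()
    total-0 : ∀ a u → total X Y w a ≡ 0 → hits X Y w u a ≡ 0
    total-0 a t4 eq = m+n≡0⇒m≡0 _ eq
    total-0 a t5 eq = m+n≡0⇒n≡0 (hits X Y w t4 a) eq
    tally : ∀ n u a → total X Y w a ≡ n → cnt (ρ u) (at s) (total X Y w a) ≡ hits X Y w u a
    tally zero u a eq = trans (cong (cnt (ρ u) (at s)) eq) (sym (total-0 a u eq))
    tally (suc n) u a eq
      with t , (_ , _ , before , walk) , ρt≡sn ← hit-at n
      with b , refl , b-eq ← after-total before
      with b′ , refl , step ← walk-arrives b refl refl walk = begin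
      cnt (ρ u) (at s) (total X Y w a)
        ≡⟨ cong (cnt (ρ u) (at s)) eq ⟩
      ind (ρ u) (at s n) + cnt (ρ u) (at s) n
        ≡⟨ cong₂ (λ z m → ind (ρ u) z + cnt (ρ u) (at s) m) (sym ρt≡sn) (sym b-eq) ⟩
      ind (ρ u) (ρ t) + cnt (ρ u) (at s) (total X Y w b)
        ≡⟨ cong₂ _+_ (ind-ρ u t) (tally n u b b-eq) ⟩
      indT u t + hits X Y w u b
        ≡⟨ sym (step u) ⟩
      hits X Y w u b′
        -- `b′` is the count at which the walk ends, while `a` is an arbitrary count with the same
        -- total.
        ≡⟨ hits-determined u b′ a (trans (total-arrives t b b′ step) (trans (cong suc b-eq) (sym eq))) ⟩
      hits X Y w u a ∎
      where open ≡-Reasoning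

_≗ˢ_ : (v w : ℕ → St) → Set
v ≗ˢ w = ∀ n → v n ≡ w n

hits-cong : ∀ X Y {v w} → v ≗ˢ w → ∀ t a → hits X Y v t a ≡ hits X Y w t a
hits-cong X Y v≗w t a = trans (cong (cnt _ _) (cnt-cong _ v≗w a)) (cnt-cong _ v≗w (cnt _ _ a))

-- Both outputs have the same tally of target 4 at every total, and their first letters agree. This
-- identifies an output supplied by `closed` with one met along a given path.
output-unique : ∀ {X Y v w s s′} → v ≗ˢ w → Output X Y v s → Output X Y w s′ →
  s 0 ≡ s′ 0 → s ≗ˢ s′
output-unique {X} {Y} {v} {w} {s} {s′} v≗w o o′ = counts-determine same
  where
  module O = Output o
  module O′ = Output o′
  same : ∀ n → cnt (O.label t4) s n ≡ cnt (O′.label t4) s′ n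
  same n with a , refl ← O.reach n = begin
    cnt (O.label t4) s (total X Y v a)    ≡⟨ O.tally t4 a ⟩
    hits X Y v t4 a                       ≡⟨ hits-cong X Y v≗w t4 a ⟩
    hits X Y w t4 a                       ≡⟨ sym (O′.tally t4 a) ⟩
    cnt (O′.label t4) s′ (total X Y w a)
      ≡⟨ cong (cnt (O′.label t4) s′) (sym (cong₂ _+_ (hits-cong X Y v≗w t4 a) (hits-cong X Y v≗w t5 a))) ⟩
    cnt (O′.label t4) s′ (total X Y v a)  ∎
    where open ≡-Reasoning

labels-distinct : ∀ {X Y w s} (o : Output X Y w s) → Output.label o t4 ≢ Output.label o t5
labels-distinct o eq = contradiction (Output.injective o eq) λ ()

-- Balanced periods

-- Balance and periodicity in one: `n = 0` says that the first 2g letters hold g of each kind, and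
-- comparing consecutive `n` gives period 2g. As 2g may be a multiple of the fundamental period, one
-- g can serve a whole cycle.
BalancedPeriod : ℕ → (ℕ → St) → Set
BalancedPeriod g w = ∀ x n → cnt x w ((g + g) + n) ≡ g + cnt x w n

multiples : ∀ (f : ℕ → ℕ) p c → (∀ n → f (p + n) ≡ c + f n) → ∀ m n → f (m * p + n) ≡ m * c + f n
multiples f p c step zero    n = refl
multiples f p c step (suc m) n = begin
  f (p + m * p + n)     ≡⟨ cong f (+-assoc p (m * p) n) ⟩
  f (p + (m * p + n))   ≡⟨ step (m * p + n) ⟩
  c + f (m * p + n)     ≡⟨ cong (c +_) (multiples f p c step m n) ⟩
  c + (m * c + f n)     ≡⟨ sym (+-assoc c (m * c) (f n)) ⟩
  c + m * c + f n       ∎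
  where open ≡-Reasoning

balanced-output : ∀ {X Y w s} (o : Output X Y w s) d g →
  (∀ t a → hits X Y w t (d + a) ≡ g + hits X Y w t a) → BalancedPeriod g s
balanced-output {X} {Y} {w} {s} o d g shift x n
  with a , refl ← Output.reach o n
  = label-case (≡⊎≡ (labels-distinct o) x)
  where
  open Output o
  total-shift : total X Y w (d + a) ≡ (g + g) + total X Y w a
  total-shift = trans (cong₂ _+_ (shift t4 a) (shift t5 a)) (lemma g _ _)
    where
    lemma : ∀ g b c → (g + b) + (g + c) ≡ (g + g) + (b + c)
    lemma = solve-∀
  label-shift : ∀ t → cnt (label t) s ((g + g) + total X Y w a) ≡ g + cnt (label t) s (total X Y w a)
  label-shift t = begin
    cnt (label t) s ((g + g) + total X Y w a) ≡⟨ cong (cnt (label t) s) (sym total-shift) ⟩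
    cnt (label t) s (total X Y w (d + a))     ≡⟨ tally t (d + a) ⟩
    hits X Y w t (d + a)                      ≡⟨ shift t a ⟩
    g + hits X Y w t a                        ≡⟨ cong (g +_) (sym (tally t a)) ⟩
    g + cnt (label t) s (total X Y w a)       ∎
    where open ≡-Reasoning
  label-case : x ≡ label t4 ⊎ x ≡ label t5 →
    cnt x s ((g + g) + total X Y w a) ≡ g + cnt x s (total X Y w a)
  label-case (inj₁ refl) = label-shift t4
  label-case (inj₂ refl) = label-shift t5

-- 4g departures from vertex 1 cause 2g from each of vertices 2 and 3, and g of each 2g hit,
-- whatever the variant.
hits-shift : ∀ {g w} → BalancedPeriod g w → ∀ X Y t a →
  hits X Y w t (((g + g) + (g + g)) + a) ≡ g + hits X Y w t a
hits-shift {g} {w} bal X Y t a = trans (cong (cnt h w) inner) (bal h _)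
  where
  h = hitLetter (variant X Y t)
  l = letter t
  inner : cnt l w (((g + g) + (g + g)) + a) ≡ (g + g) + cnt l w a
  inner = trans (cong (cnt l w) (+-assoc (g + g) (g + g) a))
    (trans (bal l _) (trans (cong (g +_) (bal l a)) (sym (+-assoc g g _))))

balanced-step : ∀ {X Y w s g} → BalancedPeriod g w → Output X Y w s → BalancedPeriod g s
balanced-step {X} {Y} {g = g} bal o = balanced-output o ((g + g) + (g + g)) g (hits-shift bal X Y)

-- In p² departures vertex 2 is visited for `c t4` full periods, each with `c t5` letters ② that
-- hit; vertex 3 is visited for `c t5` periods, each with `c t4` letters ① that hit. Both products
-- are the same g.
balanced-UD : ∀ {w s} p .{{_ : NonZero p}} → (∀ n → w (p + n) ≡ w n) → Output U D w s →
  ∃ λ g → 0 < g × BalancedPeriod g s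
balanced-UD {w} {s} p per o = g , n≢0⇒n>0 g≢0 , balanced-output o (p * p) g shift
  where
  c : Tgt → ℕ
  c t = cnt (letter t) w p
  g = c t4 * c t5
  cnt-period : ∀ x n → cnt x w (p + n) ≡ cnt x w p + cnt x w n
  cnt-period x n = trans (cnt-+ x w p n) (cong (cnt x w p +_) (cnt-cong x per n))
  shift : ∀ t a → hits U D w t (p * p + a) ≡ g + hits U D w t a
  shift t4 a = begin
    cnt ② w (cnt ① w (p * p + a))   ≡⟨ cong (cnt ② w) (multiples (cnt ① w) p (c t4) (cnt-period ①) p a) ⟩
    cnt ② w (p * c t4 + cnt ① w a)  ≡⟨ cong (λ i → cnt ② w (i + cnt ① w a)) (*-comm p (c t4)) ⟩
    cnt ② w (c t4 * p + cnt ① w a)  ≡⟨ multiples (cnt ② w) p (c t5) (cnt-period ②) (c t4) _ ⟩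
    g + hits U D w t4 a             ∎
    where open ≡-Reasoning
  shift t5 a = begin
    cnt ① w (cnt ② w (p * p + a))   ≡⟨ cong (cnt ① w) (multiples (cnt ② w) p (c t5) (cnt-period ②) p a) ⟩
    cnt ① w (p * c t5 + cnt ② w a)  ≡⟨ cong (λ i → cnt ① w (i + cnt ② w a)) (*-comm p (c t5)) ⟩
    cnt ① w (c t5 * p + cnt ② w a)  ≡⟨ multiples (cnt ① w) p (c t4) (cnt-period ①) (c t5) _ ⟩
    c t5 * c t4 + hits U D w t5 a   ≡⟨ cong (_+ hits U D w t5 a) (*-comm (c t5) (c t4)) ⟩
    g + hits U D w t5 a             ∎
    where open ≡-Reasoning
  g≢0 : g ≢ 0
  -- With g = 0 the hit counts would vanish at all multiples of p², hence everywhere by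
  -- monotonicity, and no first hit could occur.
  g≢0 g≡0 with a , total≡1 ← Output.reach o 1 = contradiction (trans (sym total≡1) (total≡0 a)) λ ()
    where
    hits≡0 : ∀ t a → hits U D w t (a * (p * p) + 0) ≡ 0
    hits≡0 t a = trans
      (multiples (hits U D w t) (p * p) 0 (λ n → trans (shift t n) (cong (_+ hits U D w t n) g≡0)) a 0)
      (cong₂ _+_ (*-zeroʳ a) (hits-0 t))
      where
      hits-0 : ∀ t → hits U D w t 0 ≡ 0
      hits-0 t4 = refl
      hits-0 t5 = refl
    a≤ : ∀ a → a ≤ a * (p * p) + 0
    a≤ a = subst (a ≤_) (sym (+-identityʳ _)) (m≤m*n a (p * p) {{m*n≢0 p p}})
    total≡0 : ∀ a → total U D w a ≡ 0
    total≡0 a = n≤0⇒n≡0 (subst (total U D w a ≤_) (cong₂ _+_ (hits≡0 t4 a) (hits≡0 t5 a))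
      (+-mono-≤ (hits-mono U D w t4 (a≤ a)) (hits-mono U D w t5 (a≤ a))))

-- The energy identity

∑ : (ℕ → ℕ) → ℕ → ℕ
∑ f zero    = 0
∑ f (suc n) = f n + ∑ f n

∑-cong : ∀ {f g} → (∀ n → f n ≡ g n) → ∀ n → ∑ f n ≡ ∑ g n
∑-cong f≗g zero    = refl
∑-cong f≗g (suc n) = cong₂ _+_ (f≗g n) (∑-cong f≗g n)

∑-+ : ∀ f m n → ∑ f (m + n) ≡ ∑ f m + ∑ (λ i → f (m + i)) n
∑-+ f m zero    = trans (cong (∑ f) (+-identityʳ m)) (sym (+-identityʳ _))
∑-+ f m (suc n) rewrite +-suc m n | ∑-+ f m n = lemma (f (m + n)) (∑ f m) _
  where
  lemma : ∀ a b c → a + (b + c) ≡ b + (a + c)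
  lemma = solve-∀

∑-distrib-+ : ∀ f g n → ∑ (λ i → f i + g i) n ≡ ∑ f n + ∑ g n
∑-distrib-+ f g zero    = refl
∑-distrib-+ f g (suc n) rewrite ∑-distrib-+ f g n = lemma (f n) (g n) _ _
  where
  lemma : ∀ a b c d → a + b + (c + d) ≡ a + c + (b + d)
  lemma = solve-∀

∑-zero : ∀ f n → ∑ f n ≡ 0 → ∀ {i} → i < n → f i ≡ 0
∑-zero f (suc n) eq {i} i<1+n with i ≟ n
... | yes refl = m+n≡0⇒m≡0 (f n) eq
... | no  i≢n  = ∑-zero f n (m+n≡0⇒n≡0 (f n) eq) (≤∧≢⇒< (s≤s⁻¹ i<1+n) i≢n)

-- `M` climbs by steps of 0 or 1, so each value from 1 to `M a` is entered exactly once, at a step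
-- with `e = 1`. With `e` marking hits, a sum over departures becomes a sum over hits.
∑-reindex : ∀ f (e M : ℕ → ℕ) → (∀ a → e a ≡ 0 ⊎ e a ≡ 1) → M 0 ≡ 0 →
  (∀ a → M (suc a) ≡ e a + M a) →
  ∀ a → ∑ (λ i → e i * f (M (suc i))) a ≡ ∑ (f ∘ suc) (M a)
∑-reindex f e M e01 M0 Ms zero    = cong (∑ (f ∘ suc)) (sym M0)
∑-reindex f e M e01 M0 Ms (suc a) with e01 a
... | inj₁ e≡0 rewrite e≡0 | Ms a | e≡0 = ∑-reindex f e M e01 M0 Ms a
... | inj₂ e≡1 rewrite e≡1 | Ms a | e≡1 = cong₂ _+_ (+-identityʳ _) (∑-reindex f e M e01 M0 Ms a)

imbalance : (ℕ → St) → ℕ → ℕ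
imbalance w n = ∣ cnt ① w n - cnt ② w n ∣

energy : ℕ → (ℕ → St) → ℕ
energy g w = ∑ (imbalance w ∘ suc) (g + g)

imbalance-labels : ∀ {x y} → x ≢ y → ∀ w n → ∣ cnt x w n - cnt y w n ∣ ≡ imbalance w n
imbalance-labels {①} {①} x≢y = contradiction refl x≢y
imbalance-labels {①} {②} x≢y w n = refl
imbalance-labels {②} {①} x≢y w n = ∣-∣-comm (cnt ② w n) (cnt ① w n)
imbalance-labels {②} {②} x≢y = contradiction refl x≢y

imbalance-period : ∀ {g w} → BalancedPeriod g w → ∀ n → imbalance w ((g + g) + n) ≡ imbalance w n
imbalance-period {g} {w} bal n = trans (cong₂ ∣_-_∣ (bal ① n) (bal ② n)) (∣m+n-m+o∣≡∣n-o∣ g _ _)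

-- How many letters h lie between the two positions that the routers at vertices 2 and 3 have
-- reached after a departures from vertex 1.
gap : St → (ℕ → St) → ℕ → ℕ
gap h w a = ∣ cnt h w (cnt ① w a) - cnt h w (cnt ② w a) ∣

-- Each difference counts one letter in the stretch of `m` positions from `k` on, and every position
-- there holds one of the two letters.
∣-∣-split-≤ : ∀ h w k m →
  ∣ cnt h w k - cnt h w (k + m) ∣ + ∣ cnt (other h) w k - cnt (other h) w (k + m) ∣ ≡ ∣ k - (k + m) ∣
∣-∣-split-≤ h w k m = begin
  ∣ cnt h w k - cnt h w (k + m) ∣ + ∣ cnt (other h) w k - cnt (other h) w (k + m) ∣
    ≡⟨ cong₂ _+_ (between h) (between (other h)) ⟩
  cnt h (λ i → w (k + i)) m + cnt (other h) (λ i → w (k + i)) m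
    ≡⟨ cnt-both (≢other h) (λ i → w (k + i)) m ⟩
  m
    ≡⟨ sym (∣m-m+n∣≡n k m) ⟩
  ∣ k - (k + m) ∣ ∎
  where
  open ≡-Reasoning
  between : ∀ x → ∣ cnt x w k - cnt x w (k + m) ∣ ≡ cnt x (λ i → w (k + i)) m
  between x = trans (cong (∣ cnt x w k -_∣) (cnt-+ x w k m)) (∣m-m+n∣≡n (cnt x w k) _)

∣-∣-split : ∀ h w k l →
  ∣ cnt h w k - cnt h w l ∣ + ∣ cnt (other h) w k - cnt (other h) w l ∣ ≡ ∣ k - l ∣
∣-∣-split h w k l with ≤-total k l
... | inj₁ k≤l = subst
  (λ l → ∣ cnt h w k - cnt h w l ∣ + ∣ cnt (other h) w k - cnt (other h) w l ∣ ≡ ∣ k - l ∣)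
  (m+[n∸m]≡n k≤l) (∣-∣-split-≤ h w k (l ∸ k))
... | inj₂ l≤k = trans (cong₂ _+_ (∣-∣-comm (cnt h w k) _) (∣-∣-comm (cnt (other h) w k) _))
  (trans (subst
    (λ k → ∣ cnt h w l - cnt h w k ∣ + ∣ cnt (other h) w l - cnt (other h) w k ∣ ≡ ∣ l - k ∣)
    (m+[n∸m]≡n l≤k) (∣-∣-split-≤ h w l (k ∸ l)))
  (∣-∣-comm l k))

-- The rotor read at vertex 2 or 3 right after departure a from vertex 1.
read : (ℕ → St) → ℕ → St
read w a = w (cnt (w a) w a)

total-step : ∀ X w a → total X X w (suc a) ≡ ind (hitLetter X) (read w a) + total X X w a
total-step X w a with w a
... | ① = +-assoc (ind (hitLetter X) (w (cnt ① w a))) _ _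
... | ② = lemma (ind (hitLetter X) (w (cnt ② w a))) (cnt (hitLetter X) w (cnt ① w a)) _
  where
  lemma : ∀ a b c → b + (a + c) ≡ a + (b + c)
  lemma = solve-∀

-- The imbalance of `s` after a hit is the gap between the two routers at that departure, and 4g
-- departures make exactly 2g hits. The factor `ind` selects the departures that hit.
energy-output : ∀ {X w s g} → BalancedPeriod g w → Output X X w s →
  energy g s ≡ ∑ (λ a → ind (hitLetter X) (read w a) * gap (hitLetter X) w (suc a)) ((g + g) + (g + g))
energy-output {X} {w} {s} {g} bal o = begin
  ∑ (imbalance s ∘ suc) (g + g)
    ≡⟨ cong (∑ (imbalance s ∘ suc)) (sym total-period) ⟩
  ∑ (imbalance s ∘ suc) (total X X w ((g + g) + (g + g)))
    ≡⟨ sym (∑-reindex (imbalance s) (λ a → ind h (read w a)) (total X X w)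
         (λ a → ind-0⊎1 h (read w a)) refl (total-step X w) ((g + g) + (g + g))) ⟩
  ∑ (λ a → ind h (read w a) * imbalance s (total X X w (suc a))) ((g + g) + (g + g))
    ≡⟨ ∑-cong (λ a → cong (ind h (read w a) *_) (imbalance-gap (suc a))) ((g + g) + (g + g)) ⟩
  ∑ (λ a → ind h (read w a) * gap h w (suc a)) ((g + g) + (g + g)) ∎
  where
  open ≡-Reasoning
  open Output o
  h = hitLetter X
  imbalance-gap : ∀ a → imbalance s (total X X w a) ≡ gap h w a
  imbalance-gap a = trans (sym (imbalance-labels (labels-distinct o) s (total X X w a)))
    (cong₂ ∣_-_∣ (tally t4 a) (tally t5 a))
  total-period : total X X w ((g + g) + (g + g)) ≡ g + g
  total-period = trans (cong (total X X w) (sym (+-identityʳ ((g + g) + (g + g)))))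
    (cong₂ _+_ (trans (hits-shift bal X X t4 0) (+-identityʳ g))
               (trans (hits-shift bal X X t5 0) (+-identityʳ g)))

-- At each departure, UU or DD accounts for the gap in the letter just read; what remains is the gap
-- in the other letter.
slack : (ℕ → St) → ℕ → ℕ
slack w a = ind ① (read w a) * gap ② w (suc a) + ind ② (read w a) * gap ① w (suc a)

-- The outputs consume 4g departures, two balanced periods of `w`, whence the doubled energy on the
-- left. Each imbalance of `w` is then split by letter with `∣-∣-split`.
energy-identity : ∀ {w s s′ g} → BalancedPeriod g w → Output U U w s → Output D D w s′ →
  energy g w + energy g w ≡ (energy g s + energy g s′) + ∑ (slack w) ((g + g) + (g + g))
energy-identity {w} {s} {s′} {g} bal oU oD = begin
  ∑ f (g + g) + ∑ f (g + g)
    ≡⟨ cong (∑ f (g + g) +_) (sym (∑-cong (λ n →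
         trans (cong (imbalance w) (sym (+-suc (g + g) n))) (imbalance-period bal (suc n))) (g + g))) ⟩
  ∑ f (g + g) + ∑ (λ i → f ((g + g) + i)) (g + g)
    ≡⟨ sym (∑-+ f (g + g) (g + g)) ⟩
  ∑ f N
    ≡⟨ ∑-cong split N ⟩
  ∑ (λ a → (termU a + termD a) + slack w a) N
    ≡⟨ trans (∑-distrib-+ _ (slack w) N) (cong (_+ ∑ (slack w) N) (∑-distrib-+ termU termD N)) ⟩
  (∑ termU N + ∑ termD N) + ∑ (slack w) N
    ≡⟨ cong (_+ ∑ (slack w) N) (sym (cong₂ _+_ (energy-output bal oU) (energy-output bal oD))) ⟩
  (energy g s + energy g s′) + ∑ (slack w) N ∎
  where
  open ≡-Reasoning
  N = (g + g) + (g + g)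
  f = imbalance w ∘ suc
  termU termD : ℕ → ℕ
  termU a = ind ② (read w a) * gap ② w (suc a)
  termD a = ind ① (read w a) * gap ① w (suc a)
  split : ∀ a → f a ≡ (termU a + termD a) + slack w a
  split a = trans (sym (∣-∣-split ① w (cnt ① w (suc a)) (cnt ② w (suc a))))
                  (by-letter (read w a) (gap ① w (suc a)) (gap ② w (suc a)))
    where
    by-letter : ∀ z p q → p + q ≡
      (ind ② z * q + ind ① z * p) + (ind ① z * q + ind ② z * p)
    by-letter ① = solve-∀
    by-letter ② = solve-∀

-- Words of zero slack

-- Positions start at 0, so a change between `k` and `suc k` forces a boundary of uniform runs after
-- `suc k` letters; the prefix of twice that length is the one required to be balanced.
ChangesBalanced : (ℕ → St) → Set
ChangesBalanced w = ∀ k → w k ≢ w (suc k) → ∀ x → cnt x w (suc k + suc k) ≡ suc k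

gap-other : ∀ w a → slack w a ≡ 0 → ∀ {h} → h ≢ read w a →
  cnt h w (cnt ① w (suc a)) ≡ cnt h w (cnt ② w (suc a))
gap-other w a slack≡0 {h} h≢ = ∣m-n∣≡0⇒m≡n (by-letter h (read w a) h≢ slack≡0)
  where
  by-letter : ∀ h z → h ≢ z →
    ind ① z * gap ② w (suc a) + ind ② z * gap ① w (suc a) ≡ 0 → gap h w (suc a) ≡ 0
  by-letter ① ① h≢z _ = contradiction refl h≢z
  by-letter ① ② _ eq = trans (sym (+-identityʳ _)) eq
  by-letter ② ① _ eq = trans (sym (+-identityʳ _)) (m+n≡0⇒m≡0 _ eq)
  by-letter ② ② h≢z _ = contradiction refl h≢z

-- Departure a, the (k+2)-nd to read x, reads the letter w (suc k) afterwards; being late, the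
-- other router has not yet passed position k, so w k ≢ w (suc k) lies in the gap.
no-excess : ∀ w k x → w k ≢ w (suc k) →
  (∀ {a} → a < suc k + suc k → slack w a ≡ 0) → ¬ suc k < cnt x w (suc k + suc k)
no-excess w k x change slack≡0 excess
  with a , a<2K , cnt-a , wa ← cnt-crossing x w (suc k + suc k) excess
  = <⇒≢ late-< (sym on-time)
  where
  h = w k
  K = suc k
  behind : cnt (other x) w a ≤ k
  behind = s≤s⁻¹ (≤-<-trans (cnt-mono (other x) w (<⇒≤ a<2K)) short)
    where
    short : cnt (other x) w (K + K) < K
    short = +-cancelˡ-< K _ _ (subst (K + cnt (other x) w (K + K) <_) (cnt-both (≢other x) w (K + K))
      (+-monoˡ-< (cnt (other x) w (K + K)) excess))
  late-< : cnt h w (cnt (other x) w a) < cnt h w (suc K)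
  late-< = ≤-<-trans (cnt-mono h w behind)
    (<-≤-trans (subst (cnt h w k <_) (sym (cnt-hit h w k refl)) ≤-refl) (cnt-mono h w (n≤1+n K)))
  h≢read : h ≢ read w a
  h≢read rewrite wa | cnt-a = change
  gap-closed : ∀ x → cnt h w (cnt x w (suc a)) ≡ cnt h w (cnt (other x) w (suc a))
  gap-closed ① = gap-other w a (slack≡0 a<2K) h≢read
  gap-closed ② = sym (gap-other w a (slack≡0 a<2K) h≢read)
  on-time : cnt h w (suc K) ≡ cnt h w (cnt (other x) w a)
  on-time = begin
    cnt h w (suc K)                    ≡⟨ cong (cnt h w) (sym (trans (cnt-hit x w a wa) (cong suc cnt-a))) ⟩
    cnt h w (cnt x w (suc a))          ≡⟨ gap-closed x ⟩
    cnt h w (cnt (other x) w (suc a))  ≡⟨ cong (cnt h w) (cnt-miss (other x) w a (λ eq → ≢other x (sym (trans eq wa)))) ⟩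
    cnt h w (cnt (other x) w a)        ∎
    where open ≡-Reasoning

-- If the letters differed, the count of `w n` would rise at position n but not at 2g + n.
balanced⇒periodic : ∀ {g w} → BalancedPeriod g w → ∀ n → w ((g + g) + n) ≡ w n
balanced⇒periodic {g} {w} bal n with w ((g + g) + n) ≟ˢ w n
... | yes eq = eq
... | no neq = contradiction (begin
  suc (cnt (w n) w ((g + g) + n))    ≡⟨ cong suc (bal (w n) n) ⟩
  suc (g + cnt (w n) w n)            ≡⟨ sym (+-suc g _) ⟩
  g + suc (cnt (w n) w n)            ≡⟨ cong (g +_) (sym (cnt-hit (w n) w n refl)) ⟩
  g + cnt (w n) w (suc n)            ≡⟨ sym (bal (w n) (suc n)) ⟩
  cnt (w n) w ((g + g) + suc n)      ≡⟨ cong (cnt (w n) w) (+-suc (g + g) n) ⟩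
  cnt (w n) w (suc ((g + g) + n))    ≡⟨ cnt-miss (w n) w ((g + g) + n) (neq ∘ sym) ⟩
  cnt (w n) w ((g + g) + n)          ∎) 1+n≢n
  where open ≡-Reasoning

-- Zero slack is known for 4g departures only, so `k` is first reduced modulo 2g. Then `no-excess`
-- bounds both letter counts by `suc k`, and as they sum to twice that, both bounds are attained.
changes-balanced : ∀ {g w} → 0 < g → BalancedPeriod g w →
  (∀ {a} → a < (g + g) + (g + g) → slack w a ≡ 0) → ChangesBalanced w
changes-balanced {g@(suc _)} {w} _ bal slack≡0 k change x =
  subst (λ k → cnt x w (suc k + suc k) ≡ suc k) (sym k≡) (begin
    cnt x w (suc (q * G + k₀) + suc (q * G + k₀))
      ≡⟨ cong (cnt x w) (rearrange q k₀ g) ⟩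
    cnt x w ((q + q) * G + (suc k₀ + suc k₀))
      ≡⟨ multiples (cnt x w) G g (bal x) (q + q) (suc k₀ + suc k₀) ⟩
    (q + q) * g + cnt x w (suc k₀ + suc k₀)
      ≡⟨ cong ((q + q) * g +_) (first-period (m%n<n k G) change₀ x) ⟩
    (q + q) * g + suc k₀
      ≡⟨ rearrange′ q k₀ g ⟩
    suc (q * G + k₀) ∎)
  where
  open ≡-Reasoning
  G = g + g
  q = k / G
  k₀ = k % G
  k≡ : k ≡ q * G + k₀
  k≡ = trans (m≡m%n+[m/n]*n k G) (+-comm k₀ _)
  rearrange : ∀ q k g → suc (q * (g + g) + k) + suc (q * (g + g) + k) ≡ (q + q) * (g + g) + (suc k + suc k)
  rearrange = solve-∀
  rearrange′ : ∀ q k g → (q + q) * g + suc k ≡ suc (q * (g + g) + k)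
  rearrange′ = solve-∀
  periodic : ∀ q n → w (q * G + n) ≡ w n
  periodic zero    n = refl
  periodic (suc q) n = trans (cong w (+-assoc G (q * G) n))
    (trans (balanced⇒periodic bal (q * G + n)) (periodic q n))
  change₀ : w k₀ ≢ w (suc k₀)
  change₀ eq = change (trans (trans (cong w k≡) (periodic q k₀))
    (trans eq (sym (trans (cong w (trans (cong suc k≡) (sym (+-suc (q * G) k₀)))) (periodic q (suc k₀))))))
  first-period : ∀ {k} → k < G → w k ≢ w (suc k) → ∀ x → cnt x w (suc k + suc k) ≡ suc k
  first-period {k} k<G change x = ≤-antisym (at-most x)
    (+-cancelʳ-≤ (suc k) _ _ (subst (_≤ cnt x w (suc k + suc k) + suc k) (cnt-both (≢other x) w (suc k + suc k))
      (+-monoʳ-≤ (cnt x w (suc k + suc k)) (at-most (other x)))))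
    where
    at-most : ∀ x → cnt x w (suc k + suc k) ≤ suc k
    at-most x = ≮⇒≥ (no-excess w k x change (λ a< → slack≡0 (<-≤-trans a< (+-mono-≤ k<G k<G))))

-- The mixed operations

uniform-block : ∀ (w : ℕ → St) k m → (∀ j → k ≤ j → suc j < k + m → w j ≡ w (suc j)) →
  ∀ j → j < m → w (k + j) ≡ w k
uniform-block w k m same zero    _     = cong w (+-identityʳ k)
uniform-block w k m same (suc j) 1+j<m = trans (cong w (+-suc k j))
  (trans (sym (same (k + j) (m≤m+n k j) (subst (_< k + m) (+-suc k j) (+-monoʳ-< k 1+j<m))))
         (uniform-block w k m same j (<-trans (n<1+n j) 1+j<m)))

cnt-absent : ∀ h w k m → (∀ j → j < m → h ≢ w (k + j)) → cnt h w k ≡ cnt h w (k + m)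
cnt-absent h w k zero    absent = cong (cnt h w) (sym (+-identityʳ k))
cnt-absent h w k (suc m) absent = trans (cnt-absent h w k m (λ j j<m → absent j (m<n⇒m<1+n j<m)))
  (trans (sym (cnt-miss h w (k + m) (absent m ≤-refl))) (cong (cnt h w) (sym (+-suc k m))))

-- The word is constant between the two routers, so the letter absent there has equal counts. Indeed
-- a change at `j` between them balances the prefix of length 2(j + 1); comparing counts of `x` puts
-- `a` before that length, counts of `y` put it after.
aligned-≤ : ∀ {w} → ChangesBalanced w → ∀ x y a → cnt x w a ≤ cnt y w a →
  ∃ λ h → cnt h w (cnt x w a) ≡ cnt h w (cnt y w a)
aligned-≤ {w} P x y a p≤q = other (w p) ,
  trans (cnt-absent (other (w p)) w p m (λ j j<m eq →
          ≢other (w p) (sym (trans eq (uniform-block w p m same j j<m)))))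
        (cong (cnt (other (w p)) w) p+m≡q)
  where
  p = cnt x w a
  q = cnt y w a
  m = q ∸ p
  p+m≡q : p + m ≡ q
  p+m≡q = m+[n∸m]≡n p≤q
  same : ∀ j → p ≤ j → suc j < p + m → w j ≡ w (suc j)
  same j p≤j 1+j<p+m with w j ≟ˢ w (suc j)
  ... | yes eq = eq
  ... | no change = contradiction
    (cnt-cancel-< x w {a} (subst (p <_) (sym (P j change x)) (s≤s p≤j)))
    (<-asym (cnt-cancel-< y w {_} {a} (subst₂ _<_ (sym (P j change y)) p+m≡q 1+j<p+m)))

aligned : ∀ {w} → ChangesBalanced w → ∀ a → ∃ λ h → cnt h w (cnt ① w a) ≡ cnt h w (cnt ② w a)
aligned {w} P a with ≤-total (cnt ① w a) (cnt ② w a)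
... | inj₁ le = aligned-≤ P ① ② a le
... | inj₂ ge = let h , eq = aligned-≤ P ② ① a ge in h , sym eq

-- The letter on which the routers agree is the hit letter of one of them. That router may be
-- imagined at the position of the other, and then the hits of both targets together count every
-- letter of one prefix of `w`, whose length is thus the total.
mixed-identity : ∀ {X Y w s} → hitLetter X ≢ hitLetter Y → ChangesBalanced w → Output X Y w s →
  s 0 ≡ w 0 → s ≗ˢ w
mixed-identity {X} {Y} {w} {s} X≢Y P o = counts-determine same
  where
  open Output o
  same : ∀ n → cnt (label t4) s n ≡ cnt (hitLetter X) w n
  same n with a , refl ← reach n = trans (tally t4 a) (hits-total a)
    where
    hits-total : ∀ a → hits X Y w t4 a ≡ cnt (hitLetter X) w (total X Y w a)
    hits-total a with h , eq ← aligned P a with ≡⊎≡ X≢Y h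
    ... | inj₁ refl = trans eq (cong (cnt (hitLetter X) w)
            (sym (trans (cong (_+ hits X Y w t5 a) eq) (cnt-both X≢Y w (cnt ② w a)))))
    ... | inj₂ refl = cong (cnt (hitLetter X) w)
            (sym (trans (cong (hits X Y w t4 a +_) (sym eq)) (cnt-both X≢Y w (cnt ① w a))))

-- Run decompositions from balanced prefixes

-- The differences of consecutive points of `J`. Having `J` at both ends will make the doubled
-- blocks balanced; having no point of `J` inside will make the blocks uniform.
data Cuts (J : ℕ → Set) : ℕ → ℕ → List ℕ → Set where
  []   : ∀ {j} → Cuts J j j []
  step : ∀ {j b e bs} → 0 < b → J j → J (j + b) → (∀ i → 0 < i → i < b → ¬ J (j + i)) →
         Cuts J (j + b) e bs → Cuts J j e (b ∷ bs)

cuts-++ : ∀ {J j e f bs cs} → Cuts J j e bs → Cuts J e f cs → Cuts J j f (bs ++ cs)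
cuts-++ []                     ds = ds
cuts-++ (step 0<b Jj Je none cs) ds = step 0<b Jj Je none (cuts-++ cs ds)

cuts-sum : ∀ {J j e bs} → Cuts J j e bs → j + sum bs ≡ e
cuts-sum []                                 = +-identityʳ _
cuts-sum (step {j} {b} {bs = bs} _ _ _ _ cs) = trans (sym (+-assoc j b (sum bs))) (cuts-sum cs)

cuts-positive : ∀ {J j e bs} → Cuts J j e bs → All (0 <_) bs
cuts-positive []                    = []
cuts-positive (step 0<b _ _ _ cs) = 0<b ∷ cuts-positive cs

+-swapʳ : ∀ a b c → (a + b) + c ≡ (a + c) + b
+-swapʳ = solve-∀

cuts-shift : ∀ {J h} → (∀ i → J i → J (i + h)) → (∀ i → J (i + h) → J i) →
  ∀ {j e bs} → Cuts J j e bs → Cuts J (j + h) (e + h) bs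
cuts-shift to from [] = []
cuts-shift {J} {h} to from (step {j} {b} {e} {bs} 0<b Jj Je none cs) =
  step 0<b (to j Jj) (subst J (+-swapʳ j b h) (to (j + b) Je))
    (λ i 0<i i<b Ji → none i 0<i i<b (from (j + i) (subst J (+-swapʳ j h i) Ji)))
    (subst (λ m → Cuts J m (e + h) bs) (+-swapʳ j b h) (cuts-shift to from cs))

-- For the induction the start `j` need not lie in `J`; the list begins at the first point of `J`
-- from `j` on.
next-cut : ∀ {J : ℕ → Set} → (∀ i → Dec (J i)) → ∀ m j → J (j + m) →
  Σ ℕ λ b → Σ (List ℕ) λ bs → (∀ i → i < b → ¬ J (j + i)) × J (j + b) × Cuts J (j + b) (j + m) bs
next-cut J? zero    j Jm = 0 , [] , (λ _ ()) , Jm , []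
next-cut {J} J? (suc m) j Jm
  with b , bs , none , Jb , cs ← next-cut {J} J? m (suc j) (subst J (+-suc j m) Jm)
  with J? j
... | yes Jj = 0 , suc b ∷ bs , (λ _ ()) , subst J (sym (+-identityʳ j)) Jj ,
      subst₂ (λ a c → Cuts J a c (suc b ∷ bs)) (sym (+-identityʳ j)) (sym (+-suc j m))
        (step z<s Jj (subst J (sym (+-suc j b)) Jb)
          (λ { (suc i) _ i<b Ji → none i (s≤s⁻¹ i<b) (subst J (+-suc j i) Ji) })
          (subst (λ a → Cuts J a (suc j + m) bs) (sym (+-suc j b)) cs))
... | no ¬Jj = suc b , bs ,
      (λ { zero _ J0 → ¬Jj (subst J (+-identityʳ j) J0)
         ; (suc i) i<b Ji → none i (s≤s⁻¹ i<b) (subst J (+-suc j i) Ji) }) ,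
      subst J (sym (+-suc j b)) Jb ,
      subst₂ (λ a c → Cuts J a c bs) (sym (+-suc j b)) (sym (+-suc j m)) cs

all-cuts : ∀ {J : ℕ → Set} → (∀ i → Dec (J i)) → ∀ h → J 0 → J h → ∃ λ bs → Cuts J 0 h bs
all-cuts {J} J? h J0 Jh with next-cut {J} J? h 0 Jh
... | zero  , bs , _  , _ , cs = bs , cs
... | suc _ , _  , none , _ , _  = contradiction J0 (none 0 z<s)

blocks : (ℕ → St) → ℕ → List ℕ → List (List St)
blocks w o []       = []
blocks w o (b ∷ bs) = applyUpTo (λ i → w (o + i)) b ∷ blocks w (o + b) bs

applyUpTo-cong : ∀ {f g : ℕ → St} → f ≗ˢ g → ∀ n → applyUpTo f n ≡ applyUpTo g n
applyUpTo-cong f≗g zero    = refl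
applyUpTo-cong f≗g (suc n) = cong₂ _∷_ (f≗g 0) (applyUpTo-cong (f≗g ∘ suc) n)

applyUpTo-+ : ∀ (f : ℕ → St) m n → applyUpTo f (m + n) ≡ applyUpTo f m ++ applyUpTo (f ∘ (m +_)) n
applyUpTo-+ f zero    n = refl
applyUpTo-+ f (suc m) n = cong (f 0 ∷_) (applyUpTo-+ (f ∘ suc) m n)

concat-blocks : ∀ w o bs → concat (blocks w o bs) ≡ applyUpTo (λ i → w (o + i)) (sum bs)
concat-blocks w o []       = refl
concat-blocks w o (b ∷ bs) = begin
  applyUpTo f b ++ concat (blocks w (o + b) bs)
    ≡⟨ cong (applyUpTo f b ++_) (concat-blocks w (o + b) bs) ⟩
  applyUpTo f b ++ applyUpTo (λ i → w (o + b + i)) (sum bs)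
    ≡⟨ cong (applyUpTo f b ++_) (applyUpTo-cong (λ i → cong w (+-assoc o b i)) (sum bs)) ⟩
  applyUpTo f b ++ applyUpTo (f ∘ (b +_)) (sum bs)
    ≡⟨ sym (applyUpTo-+ f b (sum bs)) ⟩
  applyUpTo f (b + sum bs) ∎
  where
  open ≡-Reasoning
  f = λ i → w (o + i)

blocks-nonEmpty : ∀ w o {bs} → All (0 <_) bs → All NonEmptyRun (blocks w o bs)
blocks-nonEmpty w o []             = []
blocks-nonEmpty w o (s≤s _ ∷ 0<bs) = (λ ()) ∷ blocks-nonEmpty w _ 0<bs

lengths-blocks : ∀ w o bs → map length (blocks w o bs) ≡ bs
lengths-blocks w o []       = refl
lengths-blocks w o (b ∷ bs) = cong₂ _∷_ (length-applyUpTo _ b) (lengths-blocks w (o + b) bs)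

double : ℕ → ℕ
double b = b + b

half-lengths-blocks : ∀ w o bs → map (λ b → ⌊ length b /2⌋) (blocks w o (map double bs)) ≡ bs
half-lengths-blocks w o []       = refl
half-lengths-blocks w o (b ∷ bs) = cong₂ _∷_
  (trans (cong ⌊_/2⌋ (length-applyUpTo _ (double b))) (sym (n≡⌊n+n/2⌋ b)))
  (half-lengths-blocks w (o + double b) bs)

sum-double : ∀ bs → sum (map double bs) ≡ double (sum bs)
sum-double []       = refl
sum-double (b ∷ bs) = trans (cong (double b +_) (sum-double bs)) (lemma b (sum bs))
  where
  lemma : ∀ b c → (b + b) + (c + c) ≡ (b + c) + (b + c)
  lemma = solve-∀

doubles-positive : ∀ {bs} → All (0 <_) bs → All (0 <_) (map double bs)
doubles-positive []           = []
doubles-positive (0<b ∷ 0<bs) = <-≤-trans 0<b (m≤m+n _ _) ∷ doubles-positive 0<bs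

count-∷ : ∀ x y ys → count x (y ∷ ys) ≡ ind x y + count x ys
count-∷ ① ① ys = refl
count-∷ ① ② ys = refl
count-∷ ② ① ys = refl
count-∷ ② ② ys = refl

count-applyUpTo : ∀ x w n → count x (applyUpTo w n) ≡ cnt x w n
count-applyUpTo ① w zero = refl
count-applyUpTo ② w zero = refl
count-applyUpTo x w (suc n) = begin
  count x (w 0 ∷ applyUpTo (w ∘ suc) n)   ≡⟨ count-∷ x (w 0) _ ⟩
  ind x (w 0) + count x (applyUpTo (w ∘ suc) n)
    ≡⟨ cong₂ _+_ (sym (+-identityʳ _)) (count-applyUpTo x (w ∘ suc) n) ⟩
  cnt x w 1 + cnt x (w ∘ suc) n           ≡⟨ sym (cnt-+ x w 1 n) ⟩
  cnt x w (suc n)                         ∎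
  where open ≡-Reasoning

nth : List ℕ → ℕ → Maybe ℕ
nth []       _       = nothing
nth (x ∷ xs) zero    = just x
nth (x ∷ xs) (suc n) = nth xs n

nth-lookup : ∀ xs (i : Fin (length xs)) → just (List.lookup xs i) ≡ nth xs (toℕ i)
nth-lookup (x ∷ xs) Fin.zero    = refl
nth-lookup (x ∷ xs) (Fin.suc i) = nth-lookup xs i

nth-++ˡ : ∀ xs ys {n} → n < length xs → nth (xs ++ ys) n ≡ nth xs n
nth-++ˡ (x ∷ xs) ys {zero}  _         = refl
nth-++ˡ (x ∷ xs) ys {suc n} (s≤s n<) = nth-++ˡ xs ys n<

nth-++ʳ : ∀ xs ys n → nth (xs ++ ys) (length xs + n) ≡ nth ys n
nth-++ʳ []       ys n = refl
nth-++ʳ (x ∷ xs) ys n = nth-++ʳ xs ys n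

cycAt-nth : ∀ x xs i → cycAt (x ∷ xs) i ≡ nth (x ∷ xs) (i % suc (length xs))
cycAt-nth x xs i = trans (nth-lookup (x ∷ xs) (i mod suc (length xs)))
  (cong (nth (x ∷ xs)) (toℕ-fromℕ< (m%n<n i (suc (length xs)))))

-- Needed because one copy of the cut list, doubled in length, fills a period with balanced runs,
-- while uniform runs of the plain lengths need two copies.
sameType-++ : ∀ bs → SameType bs (bs ++ bs)
sameType-++ []           i = refl
sameType-++ bs@(b ∷ cs) i = begin
  cycAt bs i                      ≡⟨ cycAt-nth b cs i ⟩
  nth bs (i % m)                  ≡⟨ cong (nth bs) (sym (m∣n⇒o%n%m≡o%m m n i (divides 2 n≡2m))) ⟩
  nth bs (j % m)                  ≡⟨ sym (nth-twice (<-≤-trans (m%n<n i n) (≤-reflexive n≡m+m))) ⟩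
  nth (bs ++ bs) j                ≡⟨ sym (cycAt-nth b (cs ++ bs) i) ⟩
  cycAt (bs ++ bs) i              ∎
  where
  open ≡-Reasoning
  m = suc (length cs)
  n = suc (length (cs ++ bs))
  j = i % n
  n≡m+m : n ≡ m + m
  n≡m+m = length-++ bs
  n≡2m : n ≡ 2 * m
  n≡2m = trans n≡m+m (cong (m +_) (sym (+-identityʳ m)))
  nth-twice : ∀ {j} → j < m + m → nth (bs ++ bs) j ≡ nth bs (j % m)
  nth-twice {j} j<2m with j <? m
  ... | yes j<m = trans (nth-++ˡ bs bs j<m) (cong (nth bs) (sym (m<n⇒m%n≡m j<m)))
  ... | no  j≮m = begin
    nth (bs ++ bs) j        ≡⟨ cong (nth (bs ++ bs)) (sym m+l≡j) ⟩
    nth (bs ++ bs) (m + l)  ≡⟨ nth-++ʳ bs bs l ⟩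
    nth bs l                ≡⟨ cong (nth bs) (sym (m<n⇒m%n≡m l<m)) ⟩
    nth bs (l % m)          ≡⟨ cong (nth bs) (sym ([m+n]%n≡m%n l m)) ⟩
    nth bs ((l + m) % m)    ≡⟨ cong (λ i → nth bs (i % m)) (trans (+-comm l m) m+l≡j) ⟩
    nth bs (j % m)          ∎
    where
    l = j ∸ m
    m+l≡j : m + l ≡ j
    m+l≡j = m+[n∸m]≡n (≮⇒≥ j≮m)
    l<m : l < m
    l<m = +-cancelˡ-< m l m (subst (_< m + m) (sym m+l≡j) j<2m)

Cut : (ℕ → St) → ℕ → Set
Cut w i = cnt ① w (i + i) ≡ i

cut-both : ∀ w {i} → Cut w i → ∀ x → cnt x w (i + i) ≡ i
cut-both w cut ①     = cut
cut-both w {i} cut ② = +-cancelˡ-≡ i _ _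
  (trans (cong (_+ cnt ② w (i + i)) (sym cut)) (cnt-both (≢other ①) w (i + i)))

blocks-balanced : ∀ {w j e bs} → Cuts (Cut w) j e bs → All BalancedL (blocks w (j + j) (map double bs))
blocks-balanced [] = []
blocks-balanced {w} (step {j} {b} {bs = bs} _ cut-j cut-jb _ cs) =
  trans (block-count ①) (sym (block-count ②)) ∷
  subst (λ o → All BalancedL (blocks w o (map double bs))) (sym rearrange) (blocks-balanced cs)
  where
  rearrange : (j + j) + (b + b) ≡ (j + b) + (j + b)
  rearrange = lemma j b
    where
    lemma : ∀ j b → (j + j) + (b + b) ≡ (j + b) + (j + b)
    lemma = solve-∀
  block-count : ∀ x → count x (applyUpTo (λ i → w ((j + j) + i)) (b + b)) ≡ b
  block-count x = +-cancelˡ-≡ j _ _ (begin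
    j + count x (applyUpTo (λ i → w ((j + j) + i)) (b + b))
      ≡⟨ cong₂ _+_ (sym (cut-both w cut-j x)) (count-applyUpTo x _ (b + b)) ⟩
    cnt x w (j + j) + cnt x (λ i → w ((j + j) + i)) (b + b)
      ≡⟨ sym (cnt-+ x w (j + j) (b + b)) ⟩
    cnt x w ((j + j) + (b + b))
      ≡⟨ cong (cnt x w) rearrange ⟩
    cnt x w ((j + b) + (j + b))
      ≡⟨ cut-both w cut-jb x ⟩
    j + b ∎)
    where open ≡-Reasoning

-- A change inside a block would, by `ChangesBalanced`, create a cut strictly inside it.
blocks-uniform : ∀ {w j e bs} → ChangesBalanced w → Cuts (Cut w) j e bs → All Uniform (blocks w j bs)
blocks-uniform P [] = []
blocks-uniform {w} P (step {j} {b} _ _ _ no-cut cs) =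
  (w j , All.applyUpTo⁺₁ _ b (λ {i} → uniform-block w j b same i)) ∷ blocks-uniform P cs
  where
  same : ∀ i → j ≤ i → suc i < j + b → w i ≡ w (suc i)
  same i j≤i 1+i<j+b with w i ≟ˢ w (suc i)
  ... | yes eq = eq
  ... | no change = contradiction (subst (Cut w) (sym j+d≡1+i) (P i change ①)) (no-cut d 0<d d<b)
    where
    d = suc i ∸ j
    j+d≡1+i : j + d ≡ suc i
    j+d≡1+i = m+[n∸m]≡n (m≤n⇒m≤1+n j≤i)
    0<d : 0 < d
    0<d = m<n⇒0<n∸m (s≤s j≤i)
    d<b : d < b
    d<b = +-cancelˡ-< j d b (subst (_< j + b) (sym j+d≡1+i) 1+i<j+b)

-- Fundamental periods and the BURD property

toList-applyUpTo : ∀ {n} (v : Vec St n) w → (∀ i → Vec.lookup v i ≡ w (toℕ i)) → toList v ≡ applyUpTo w n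
toList-applyUpTo Vec.[]       w eq = refl
toList-applyUpTo (x Vec.∷ v) w eq = cong₂ _∷_ (eq Fin.zero) (toList-applyUpTo v (w ∘ suc) (eq ∘ Fin.suc))

period-applyUpTo : ∀ r → period r ≡ applyUpTo (at r) (suc (k r))
period-applyUpTo r = toList-applyUpTo (word r) (at r) λ i → cong (Vec.lookup (word r))
  (toℕ-injective (sym (trans (toℕ-fromℕ< (m%n<n (toℕ i) (suc (k r)))) (m<n⇒m%n≡m (toℕ<n i)))))

at-periodic : ∀ r n → at r (suc (k r) + n) ≡ at r n
at-periodic r n = cong (Vec.lookup (word r)) (toℕ-injective (begin
  toℕ ((p + n) mod p)  ≡⟨ toℕ-fromℕ< (m%n<n (p + n) p) ⟩
  (p + n) % p          ≡⟨ cong (_% p) (+-comm p n) ⟩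
  (n + p) % p          ≡⟨ [m+n]%n≡m%n n p ⟩
  n % p                ≡⟨ sym (toℕ-fromℕ< (m%n<n n p)) ⟩
  toℕ (n mod p)        ∎))
  where
  open ≡-Reasoning
  p = suc (k r)

-- Counts `x` in a prefix of length 2gp twice: as 2g copies of the period p and as p copies of the
-- balanced period 2g.
period-balanced : ∀ {w p g} → 0 < g → BalancedPeriod g w → (∀ n → w (p + n) ≡ w n) →
  ∀ x → cnt x w p + cnt x w p ≡ p
period-balanced {w} {p} {g@(suc _)} _ bal per x = *-cancelˡ-≡ _ _ g (begin
  g * (c + c)                  ≡⟨ lemma g c ⟩
  (g + g) * c + 0              ≡⟨ sym (multiples (cnt x w) p c (λ n → trans (cnt-+ x w p n) (cong (c +_) (cnt-cong x per n))) (g + g) 0) ⟩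
  cnt x w ((g + g) * p + 0)    ≡⟨ cong (λ i → cnt x w (i + 0)) (*-comm (g + g) p) ⟩
  cnt x w (p * (g + g) + 0)    ≡⟨ multiples (cnt x w) (g + g) g (bal x) p 0 ⟩
  p * g + 0                    ≡⟨ trans (+-identityʳ _) (*-comm p g) ⟩
  g * p                        ∎)
  where
  open ≡-Reasoning
  c = cnt x w p
  lemma : ∀ g c → g * (c + c) ≡ (g + g) * c + 0
  lemma = solve-∀

burd : ∀ {g} r → 0 < g → BalancedPeriod g (at r) → ChangesBalanced (at r) → BURD r
burd {g} r 0<g bal P = balanced-period , brd , urd , same-type
  where
  open ≡-Reasoning
  w = at r
  p = suc (k r)
  h = cnt ① w p
  h+h≡p : h + h ≡ p
  h+h≡p = period-balanced 0<g bal (at-periodic r) ①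
  counts-agree : ∀ x → cnt x w p ≡ h
  counts-agree ① = refl
  counts-agree ② = +-cancelˡ-≡ h _ _ (trans (cnt-both (≢other ①) w p) (sym h+h≡p))
  balanced-period : Balanced r
  balanced-period = trans (count-period ①) (sym (count-period ②))
    where
    count-period : ∀ x → count x (period r) ≡ h
    count-period x = trans (cong (count x) (period-applyUpTo r))
      (trans (count-applyUpTo x w p) (counts-agree x))
  -- Moving `i` by h lengthens the prefix by a whole period, which holds h letters ①, so the set of
  -- cuts is invariant under translation by h.
  cut-shift : ∀ i → cnt ① w ((i + h) + (i + h)) ≡ cnt ① w (i + i) + h
  cut-shift i = begin
    cnt ① w ((i + h) + (i + h))      ≡⟨ cong (cnt ① w) (lemma i h) ⟩
    cnt ① w ((h + h) + (i + i))      ≡⟨ cong (λ p → cnt ① w (p + (i + i))) h+h≡p ⟩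
    cnt ① w (p + (i + i))            ≡⟨ cnt-+ ① w p (i + i) ⟩
    h + cnt ① (λ j → w (p + j)) (i + i) ≡⟨ cong (h +_) (cnt-cong ① (at-periodic r) (i + i)) ⟩
    h + cnt ① w (i + i)              ≡⟨ +-comm h _ ⟩
    cnt ① w (i + i) + h              ∎
    where
    lemma : ∀ i h → (i + h) + (i + h) ≡ (h + h) + (i + i)
    lemma = solve-∀
  cuts : ∃ λ bs → Cuts (Cut w) 0 h bs
  cuts = all-cuts (λ i → cnt ① w (i + i) ≟ i) h refl (cong (cnt ① w) h+h≡p)
  bs = proj₁ cuts
  first  = proj₂ cuts
  second = cuts-shift (λ i cut → trans (cut-shift i) (cong (_+ h) cut))
                      (λ i cut → +-cancelʳ-≡ h _ _ (trans (sym (cut-shift i)) cut)) first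
  -- The cuts up to h and their translates together span the period 2h.
  twice : Cuts (Cut w) 0 (h + h) (bs ++ bs)
  twice = cuts-++ first second
  brd : BRD (period r)
  brd = record
    { runs     = blocks w 0 (map double bs)
    ; covers   = trans (concat-blocks w 0 (map double bs)) (trans
        (cong (applyUpTo w) (trans (sum-double bs) (trans (cong double (cuts-sum first)) h+h≡p)))
        (sym (period-applyUpTo r)))
    ; nonEmpty = blocks-nonEmpty w 0 (doubles-positive (cuts-positive first))
    ; balanced = blocks-balanced first
    }
  urd : URD (period r)
  urd = record
    { runs     = blocks w 0 (bs ++ bs)
    ; covers   = trans (concat-blocks w 0 (bs ++ bs)) (trans
        (cong (applyUpTo w) (trans (cuts-sum twice) h+h≡p)) (sym (period-applyUpTo r)))
    ; nonEmpty = blocks-nonEmpty w 0 (cuts-positive twice)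
    ; uniform  = blocks-uniform P twice
    }
  same-type : SameType (brdType brd) (urdType urd)
  same-type = subst₂ SameType (sym (half-lengths-blocks w 0 bs)) (sym (lengths-blocks w 0 (bs ++ bs)))
    (sameType-++ bs)

-- Descent along a fixed cycle

at-start : ∀ r s → at r 0 ≡ at s 0
at-start r s = trans (startsOne r) (sym (startsOne s))

balanced-reachable : ∀ {g r s} → BalancedPeriod g (at r) → Reachable r s → BalancedPeriod g (at s)
balanced-reachable bal ε = bal
balanced-reachable {r = r} bal (_◅_ {j = s} (X , Y , op) path) =
  balanced-reachable {r = s} (balanced-step bal (op-output X Y r s op)) path

changes-balanced-cong : ∀ {v w} → v ≗ˢ w → ChangesBalanced v → ChangesBalanced w
changes-balanced-cong v≗w P k change x = trans (sym (cnt-cong x v≗w _))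
  (P k (λ eq → change (trans (sym (v≗w k)) (trans eq (v≗w (suc k))))) x)

module _ {ℓ} (C : RotorType → Set ℓ) (fc : FixedCycle C) {g : ℕ} (0<g : 0 < g)
         (bal : ∀ c → C c → BalancedPeriod g (at c)) (r : RotorType) (r∈C : C r) where
  open FixedCycle fc

  F : RotorType → ℕ
  F c = energy g (at c)

  -- Along the path from y, which agrees with c ∈ C, either the energy stays minimal or UU or DD
  -- drops it, in which case the argument restarts at the lower energy.
  follow : ∀ {m} → (∀ c → C c → F c < m → ChangesBalanced (at r)) →
    ∀ c → C c → F c ≡ m → ∀ y → at y ≗ˢ at c → Reachable y r → ChangesBalanced (at r)
  follow {m} restart c c∈C Fc≡m y y≗c path
    with u , opU , u∈C ← closed c c∈C U U
    with d , opD , d∈C ← closed c c∈C D D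
    with oU ← op-output U U c u opU
    with oD ← op-output D D c d opD
    with F u <? m | F d <? m
  ... | yes Fu<m | _ = restart u u∈C Fu<m
  ... | no _ | yes Fd<m = restart d d∈C Fd<m
  ... | no Fu≮m | no Fd≮m = next-step path
    where
    S = ∑ (slack (at c)) ((g + g) + (g + g))
    identity : m + m ≡ (F u + F d) + S
    identity = trans (cong₂ _+_ (sym Fc≡m) (sym Fc≡m)) (energy-identity (bal c c∈C) oU oD)
    Fu+Fd≤ : F u + F d ≤ m + m
    Fu+Fd≤ = subst (F u + F d ≤_) (sym identity) (m≤m+n _ S)
    Fu≡m : F u ≡ m
    Fu≡m = ≤-antisym (+-cancelʳ-≤ m _ _ (≤-trans (+-monoʳ-≤ (F u) (≮⇒≥ Fd≮m)) Fu+Fd≤)) (≮⇒≥ Fu≮m)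
    Fd≡m : F d ≡ m
    Fd≡m = ≤-antisym (+-cancelˡ-≤ m _ _ (≤-trans (+-monoˡ-≤ (F d) (≮⇒≥ Fu≮m)) Fu+Fd≤)) (≮⇒≥ Fd≮m)
    S≡0 : S ≡ 0
    S≡0 = +-cancelˡ-≡ (m + m) _ _ (trans (trans (cong (_+ S) (sym (cong₂ _+_ Fu≡m Fd≡m))) (sym identity))
      (sym (+-identityʳ _)))
    P : ChangesBalanced (at c)
    P = changes-balanced 0<g (bal c c∈C) (∑-zero (slack (at c)) _ S≡0)
    next-step : Reachable y r → ChangesBalanced (at r)
    next-step ε = changes-balanced-cong (sym ∘ y≗c) P
    next-step (_◅_ {j = z} (X , Y , op) path) with op-output X Y y z op
    -- `z` is not known to lie in `C`, but `u` does and carries the same sequence, so `u` takes over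
    -- as the companion of the path.
    next-step (_◅_ {j = z} (U , U , op) path) | o =
      follow restart u u∈C Fu≡m z (output-unique y≗c o oU (at-start z u)) path
    next-step (_◅_ {j = z} (D , D , op) path) | o =
      follow restart d d∈C Fd≡m z (output-unique y≗c o oD (at-start z d)) path
    next-step (_◅_ {j = z} (U , D , op) path) | o = follow restart c c∈C Fc≡m z z≗c path
      where
      z≗c : at z ≗ˢ at c
      z≗c n = trans (mixed-identity (λ ()) (changes-balanced-cong (sym ∘ y≗c) P) o (at-start z y) n) (y≗c n)
    next-step (_◅_ {j = z} (D , U , op) path) | o = follow restart c c∈C Fc≡m z z≗c path
      where
      z≗c : at z ≗ˢ at c
      z≗c n = trans (mixed-identity (λ ()) (changes-balanced-cong (sym ∘ y≗c) P) o (at-start z y) n) (y≗c n)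

  -- Every restart takes a fresh path to `r` from the element of lower energy, supplied by
  -- `connected`.
  descent : ∀ c → C c → Acc _<_ (F c) → ChangesBalanced (at r)
  descent c c∈C (acc rec) = follow (λ c′ c′∈C lt → descent c′ c′∈C (rec lt))
    c c∈C refl c (λ _ → refl) (connected c r c∈C r∈C)

theorem7p12 : ∀ {ℓ : Level} (C : RotorType → Set ℓ) → FixedCycle C →
    ∀ r → C r → BURD r
theorem7p12 C fc r r∈C
  -- One UD step produces a balanced element; since everything in `C` is reachable from it, its g
  -- serves all of `C`, including `r`.
  with s , op , s∈C ← FixedCycle.closed fc r r∈C U D
  with g , 0<g , bal-s ← balanced-UD (suc (k r)) (at-periodic r) (op-output U D r s op) =
  burd r 0<g (bal r r∈C)
    (descent C fc 0<g bal r r∈C r r∈C (<-wellFounded _))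
  where
  bal : ∀ c → C c → BalancedPeriod g (at c)
  bal c c∈C = balanced-reachable bal-s (FixedCycle.connected fc s c s∈C c∈C)
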